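{- Let $\langle\mathcal A,\mathcal C,\vdash\rangle$ be a soft constraint system with set $\Delta$ of non-logical axioms, where $\Delta$ contains an equality theory. Let $\mathit{Var}$ be the denumerable set of variables, let $D=\{\,!^{\top_{\mathcal A}}(x=y)\mid x,y\in \mathit{Var}\}$ with diagonal elements $d_{xy}={!^{\top_{\mathcal A}}}(x=y)$, and for constraints $c,d$ let $c\leq d$ iff $d\vdash c$. Then the structure $\langle \mathcal C,\leq,\otimes,\mathbf 1,\mathbf 0,\mathit{Var},\exists,D\rangle$ is a cylindric constraint system.
   Context: **C-semiring.** A tuple $\langle \mathcal A,+_{\mathcal A},\times_{\mathcal A},\bot_{\mathcal A},\top_{\mathcal A}\rangle$ where $+_{\mathcal A}$ is a commutative, associative, idempotent binary operation on the set $\mathcal A$ with unit $\bot_{\mathcal A}$ and absorbing element $\top_{\mathcal A}$; $\times_{\mathcal A}$ is an associative, commutative binary operation on $\mathcal A$ with unit $\top_{\mathcal A}$ and absorbing element $\bot_{\mathcal A}$, and it distributes over $+_{\mathcal A}$. The order is $a\leq_{\mathcal A} b$ iff $a+_{\mathcal A}b=b$, and $\langle\mathcal A,\leq_{\mathcal A}\rangle$ is a complete lattice with bottom $\bot_{\mathcal A}$, top $\top_{\mathcal A}$ and least upper bound operation $+_{\mathcal A}$; $+_{\mathcal A}$ and $\times_{\mathcal A}$ are monotone and $a\times_{\mathcal A}b\leq_{\mathcal A}a$. **SELL.** A subexponential signature is $\Sigma=\langle I,\preceq,U\rangle$ with $I$ a set of labels, $\preceq$ a pre-order on $I$, and $U\subseteq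 I$ upwardly closed under $\preceq$. The system $\mathrm{SELL}_\Sigma$ is the intuitionistic two-sided sequent calculus (left side a multiset of formulas, right side one formula) with the initial rule ($A\longrightarrow A$), the usual intuitionistic linear logic left/right rules for $\otimes,\mathbf 1,\multimap,\&,\exists,\forall$, the right rule $\Gamma\longrightarrow\top$, and, in place of the exponential $!$, a connective $!^a$ for each $a\in I$ with rules: - dereliction: from $\Gamma,F\longrightarrow G$ infer $\Gamma,!^aF\longrightarrow G$; - promotion: from $!^{a_1}F_1,\dots,!^{a_n}F_n\longrightarrow F$ infer $!^{a_1}F_1,\dots,!^{a_n}F_n\longrightarrow {!^a}F$, provided $a\preceq a_i$ for all $1\le i\le n$; - for $b\in U$, weakening (from $\Gamma\longrightarrow G$ infer $\Gamma,!^bF\longrightarrow G$) and contraction (from $\Gamma,!^bF,!^bF\longrightarrow G$ infer $\Gamma,!^bF\longrightarrow G$). The constant $\mathbf 0$ has the usual left rule: $\Gamma,\mathbf 0\longrightarrow G$ is provable for all $\Gamma,G$. **Soft constraint system.** Let $\langle \mathcal A,+_{\mathcal A},\times_{\mathcal A},\bot_{\mathcal A},\top_{\mathcal A}\rangle$ be a c-semiring, $\mathcal P$ a first-order signature, and $\Sigma=\langle\mathcal A,\leq_{\mathcal A},\mathcal A\rangle$ (so every subexponential allows weakening and contraction). Constraints (elements of $\mathcal C$) are formulas built by the grammar $$C::=\mathbf 1\mid C\otimes C\mid \exists x.(C)\mid {!^a}A\mid {!^a}({!^a}A_1\otimes\cdots\otimes {!^a}A_n),$$ where $a\in\mathcal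 A$ and $A,A_i$ are atomic formulas over $\mathcal P$; the constant $\mathbf 0$ is also taken as a constraint, as greatest element. Let $\Delta=\{\delta_1,\dots,\delta_n\}$ be a set of non-logical axioms, each of the form $\forall\vec x_i.(c_i\multimap d_i)$, with $c_i,d_i$ constraints and all free variables of $c_i$ and of $d_i$ among $\vec x_i$ (so the axioms are closed formulas). The soft constraint system is $\langle\mathcal A,\mathcal C,\vdash\rangle$, where $d\vdash c$ iff the sequent $!^{\top_{\mathcal A}}\delta_1,\dots,!^{\top_{\mathcal A}}\delta_n,d\longrightarrow c$ is provable in $\mathrm{SELL}_\Sigma$. **Equality theory.** $\mathcal P$ contains a binary predicate $=$, and $\Delta$ gives it the meaning of equality (reflexivity and replacement of equals): $\mathbf 1\vdash {!^{\top_{\mathcal A}}}(x=x)$, $\ {!^{\top_{\mathcal A}}}(x=y)\otimes c\vdash c[y/x]$ and $\ {!^{\top_{\mathcal A}}}(x=y)\otimes c[y/x]\vdash c$ for all variables $x,y$ and constraints $c$. **Cylindric constraint system.** A structure $\langle \mathcal C,\leq,\sqcup,\mathbf 1,\mathbf 0,\mathit{Var},\exists,D\rangle$, where $c\equiv d$ means $c\leq d$ and $d\leq c$ (elements are considered up to $\equiv$), such that: - $\langle\mathcal C,\leq,\sqcup,\mathbf 1,\mathbf 0\rangle$ is a lattice with $\sqcup$ the least upper bound operation, $\mathbf 1$ the least and $\mathbf 0$ the greatest element; - $\mathit{Var}$ is a denumerable set of variables; - for each $x\in\mathit{Var}$, $\exists x:\mathcal C\to\mathcal C$ satisfies (E1)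 $\exists x(c)\leq c$; (E2) if $c\leq d$ then $\exists x(c)\leq\exists x(d)$; (E3) $\exists x(c\sqcup\exists x(d))\equiv\exists x(c)\sqcup\exists x(d)$; (E4) $\exists x\exists y(c)\equiv\exists y\exists x(c)$; - for all $x,y\in\mathit{Var}$ the diagonal element $d_{xy}\in D$ satisfies (D1) $d_{xx}\equiv\mathbf 1$; (D2) if $z$ is different from $x,y$, then $d_{xy}\equiv\exists z(d_{xz}\sqcup d_{zy})$; (D3) if $x$ is different from $y$, then $c\leq d_{xy}\sqcup\exists x(c\sqcup d_{xy})$.
   Formalization: "Lattice" is proved as: partial order up to ≡ with ⊗ as least upper bound, 1 least and 0 greatest; existence of greatest lower bounds is not claimed, since it fails for some Δ (e.g. axioms making ∃x A(x) and ∃x B(x) each entail arbitrarily long R-chains). -}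

module Defs where

open import Algebra.Bundles using (CommutativeSemiring)
open import Algebra.Definitions using (Idempotent; Zero)
open import Data.Fin using (Fin; zero; suc)
open import Data.List using (List; []; _∷_; _++_; [_]; map; foldr)
open import Data.List.Membership.Propositional using (_∈_; _∉_)
open import Data.List.Relation.Binary.Permutation.Propositional using (_↭_)
open import Data.List.Relation.Unary.All using (All)
open import Data.Nat using (ℕ; zero; suc; _≟_)
open import Data.Product using (Σ-syntax; ∃; ∃₂; _×_; _,_; proj₁)
open import Data.Vec using (Vec; []; _∷_)
open import Function using (_∘_; _↔_)
open import Level using (Level; 0ℓ; _⊔_) renaming (suc to lsuc)
open import Relation.Binary using (Rel; Maximum; IsPreorder)
open import Relation.Binary.Lattice using (IsBoundedJoinSemilattice)
open import Relation.Binary.PropositionalEquality using (_≡_; _≢_)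
open import Relation.Nullary using (yes; no)
open import Relation.Unary as Unary using (Pred)

------------------------------------------------------------------------
-- C-semirings

module _ {a ℓ} {A : Set a} (_≤_ : Rel A ℓ) where

  IsLub : ∀ {p} → Pred A p → A → Set (a ⊔ ℓ ⊔ p)
  IsLub P s = (∀ x → P x → x ≤ s) × (∀ u → (∀ x → P x → x ≤ u) → s ≤ u)

  IsGlb : ∀ {p} → Pred A p → A → Set (a ⊔ ℓ ⊔ p)
  IsGlb P s = (∀ x → P x → s ≤ x) × (∀ l → (∀ x → P x → l ≤ x) → l ≤ s)

  IsComplete : (p : Level) → Set (a ⊔ ℓ ⊔ lsuc p)
  IsComplete p = (P : Pred A p) → ∃ (IsLub P) × ∃ (IsGlb P)

-- Completeness is the only order-theoretic requirement that does not follow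
-- from the equations: that ≤ is a partial order with bounds ⊥ and ⊤ and join
-- _+_, the monotonicity of _+_ and _*_, and a * b ≤ a are all derivable.

record CSemiring c ℓ : Set (lsuc (c ⊔ ℓ)) where
  field
    commutativeSemiring : CommutativeSemiring c ℓ

  open CommutativeSemiring commutativeSemiring public
    renaming (0# to ⊥; 1# to ⊤)

  infix 4 _≤_

  _≤_ : Rel Carrier ℓ
  a ≤ b = a + b ≈ b

  field
    +-idem   : Idempotent _≈_ _+_
    +-zero   : Zero _≈_ ⊤ _+_
    complete : IsComplete _≤_ (c ⊔ ℓ)

  ≤-isPreorder : IsPreorder _≈_ _≤_
  ≤-isPreorder = record
    { isEquivalence = isEquivalence
    ; reflexive     = λ {a} {b} a≈b → trans (+-congʳ a≈b) (+-idem b)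
    ; trans         = λ {a} {b} {c} a≤b b≤c →
        trans (+-congˡ (sym b≤c))
        (trans (sym (+-assoc a b c))
        (trans (+-congʳ a≤b) b≤c))
    }

------------------------------------------------------------------------
-- Signatures

record SubexpSignature i ℓ₁ ℓ₂ u : Set (lsuc (i ⊔ ℓ₁ ⊔ ℓ₂ ⊔ u)) where
  infix 4 _≈_ _⪯_
  field
    I           : Set i
    _≈_         : Rel I ℓ₁
    _⪯_         : Rel I ℓ₂
    isPreorder  : IsPreorder _≈_ _⪯_
    U           : Pred I u
    U-upClosed  : ∀ {a b} → a ⪯ b → U a → U b

record FirstOrderSignature f r : Set (lsuc (f ⊔ r)) where
  field
    FunSym  : ℕ → Set f
    PredSym : ℕ → Set r

Var : Set
Var = ℕ

------------------------------------------------------------------------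
-- First-order terms and formulas, up to α-equivalence
--
-- Locally nameless representation: free variables are names, variables
-- bound by a quantifier are de Bruijn indices.  `Formula n` has n dangling
-- indices; the formulas proper are those of type `Formula 0`.

module Syntax {i f r} (I : Set i) (𝒫 : FirstOrderSignature f r) where

  open FirstOrderSignature 𝒫

  data Term (n : ℕ) : Set f where
    free  : Var → Term n
    bound : Fin n → Term n
    fun   : ∀ {k} → FunSym k → Vec (Term n) k → Term n

  infixr 8 _⊗_
  infixr 7 _&_
  infixr 6 _⊸_

  data Formula (n : ℕ) : Set (i ⊔ f ⊔ r) where
    atom        : ∀ {k} → PredSym k → Vec (Term n) k → Formula n
    𝟏 𝟎 ⊤′      : Formula n
    _⊗_ _⊸_ _&_ : Formula n → Formula n → Formula n
    ∃′ ∀′       : Formula (suc n) → Formula n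
    !           : I → Formula n → Formula n

  mutual
    substT : ∀ {m n} → (Var → Term n) → (Fin m → Term n) → Term m → Term n
    substT σ ρ (free x)   = σ x
    substT σ ρ (bound j)  = ρ j
    substT σ ρ (fun g ts) = fun g (substTs σ ρ ts)

    substTs : ∀ {m n k} → (Var → Term n) → (Fin m → Term n) →
              Vec (Term m) k → Vec (Term n) k
    substTs σ ρ []       = []
    substTs σ ρ (t ∷ ts) = substT σ ρ t ∷ substTs σ ρ ts

  weaken : ∀ {n} → Term n → Term (suc n)
  weaken = substT free (bound ∘ suc)

  lift : ∀ {m n} → (Fin m → Term n) → Fin (suc m) → Term (suc n)
  lift ρ zero    = bound zero
  lift ρ (suc j) = weaken (ρ j)

  subst : ∀ {m n} → (Var → Term n) → (Fin m → Term n) → Formula m → Formula n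
  subst σ ρ (atom p ts) = atom p (substTs σ ρ ts)
  subst σ ρ 𝟏           = 𝟏
  subst σ ρ 𝟎           = 𝟎
  subst σ ρ ⊤′          = ⊤′
  subst σ ρ (A ⊗ B)     = subst σ ρ A ⊗ subst σ ρ B
  subst σ ρ (A ⊸ B)     = subst σ ρ A ⊸ subst σ ρ B
  subst σ ρ (A & B)     = subst σ ρ A & subst σ ρ B
  subst σ ρ (∃′ A)      = ∃′ (subst (weaken ∘ σ) (lift ρ) A)
  subst σ ρ (∀′ A)      = ∀′ (subst (weaken ∘ σ) (lift ρ) A)
  subst σ ρ (! a A)     = ! a (subst σ ρ A)

  -- The instance of the body A of a quantifier at t.
  _⟨_⟩ : Formula 1 → Term 0 → Formula 0
  A ⟨ t ⟩ = subst free (λ _ → t) A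

  infixl 10 _[_/_]

  single : ∀ {n} → Var → Term n → Var → Term n
  single x t z with z ≟ x
  ... | yes _ = t
  ... | no  _ = free z

  _[_/_] : Formula 0 → Var → Var → Formula 0
  A [ y / x ] = subst (single x (free y)) (λ ()) A

  abstr : Var → Formula 0 → Formula 1
  abstr x = subst (single x (bound zero)) (λ ())

  infix 9 ∃[_]_ ∀[_]_

  ∃[_]_ ∀[_]_ : Var → Formula 0 → Formula 0
  ∃[ x ] A = ∃′ (abstr x A)
  ∀[ x ] A = ∀′ (abstr x A)

  mutual
    fvT : ∀ {n} → Term n → List Var
    fvT (free x)   = [ x ]
    fvT (bound _)  = []
    fvT (fun _ ts) = fvTs ts

    fvTs : ∀ {n k} → Vec (Term n) k → List Var
    fvTs []       = []
    fvTs (t ∷ ts) = fvT t ++ fvTs ts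

  fv : ∀ {n} → Formula n → List Var
  fv (atom _ ts) = fvTs ts
  fv 𝟏           = []
  fv 𝟎           = []
  fv ⊤′          = []
  fv (A ⊗ B)     = fv A ++ fv B
  fv (A ⊸ B)     = fv A ++ fv B
  fv (A & B)     = fv A ++ fv B
  fv (∃′ A)      = fv A
  fv (∀′ A)      = fv A
  fv (! _ A)     = fv A

  infix 4 _#_

  _#_ : ∀ {n} → Var → Formula n → Set
  x # A = x ∉ fv A

------------------------------------------------------------------------
-- The sequent calculus SELL (cut is not a rule)

module SELL {i ℓ₁ ℓ₂ u f r}
            (S : SubexpSignature i ℓ₁ ℓ₂ u) (𝒫 : FirstOrderSignature f r) where

  open SubexpSignature S using (I; _⪯_; U)
  open Syntax I 𝒫

  data BangedAbove (a : I) : Formula 0 → Set (i ⊔ ℓ₂ ⊔ f ⊔ r) where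
    banged : ∀ {b F} → a ⪯ b → BangedAbove a (! b F)

  infix 3 _⟶_

  -- Antecedents are multisets: lists together with the rule `exch`.
  data _⟶_ : List (Formula 0) → Formula 0 → Set (i ⊔ ℓ₂ ⊔ u ⊔ f ⊔ r) where
    init  : ∀ {A} → [ A ] ⟶ A
    exch  : ∀ {Γ Γ′ G} → Γ ↭ Γ′ → Γ ⟶ G → Γ′ ⟶ G

    ⊗L    : ∀ {Γ A B G} → A ∷ B ∷ Γ ⟶ G → A ⊗ B ∷ Γ ⟶ G
    ⊗R    : ∀ {Γ Γ′ A B} → Γ ⟶ A → Γ′ ⟶ B → Γ ++ Γ′ ⟶ A ⊗ B
    𝟏L    : ∀ {Γ G} → Γ ⟶ G → 𝟏 ∷ Γ ⟶ G
    𝟏R    : [] ⟶ 𝟏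
    ⊸L    : ∀ {Γ Γ′ A B G} → Γ ⟶ A → B ∷ Γ′ ⟶ G → A ⊸ B ∷ Γ ++ Γ′ ⟶ G
    ⊸R    : ∀ {Γ A B} → A ∷ Γ ⟶ B → Γ ⟶ A ⊸ B
    &L₁   : ∀ {Γ A B G} → A ∷ Γ ⟶ G → A & B ∷ Γ ⟶ G
    &L₂   : ∀ {Γ A B G} → B ∷ Γ ⟶ G → A & B ∷ Γ ⟶ G
    &R    : ∀ {Γ A B} → Γ ⟶ A → Γ ⟶ B → Γ ⟶ A & B
    ⊤R    : ∀ {Γ} → Γ ⟶ ⊤′
    𝟎L    : ∀ {Γ G} → 𝟎 ∷ Γ ⟶ G

    ∃L    : ∀ {Γ A G} (x : Var) → x # A → All (x #_) Γ → x # G →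
            A ⟨ free x ⟩ ∷ Γ ⟶ G → ∃′ A ∷ Γ ⟶ G
    ∃R    : ∀ {Γ A} (t : Term 0) → Γ ⟶ A ⟨ t ⟩ → Γ ⟶ ∃′ A
    ∀L    : ∀ {Γ A G} (t : Term 0) → A ⟨ t ⟩ ∷ Γ ⟶ G → ∀′ A ∷ Γ ⟶ G
    ∀R    : ∀ {Γ A} (x : Var) → x # A → All (x #_) Γ →
            Γ ⟶ A ⟨ free x ⟩ → Γ ⟶ ∀′ A

    der   : ∀ {Γ a F G} → F ∷ Γ ⟶ G → ! a F ∷ Γ ⟶ G
    prom  : ∀ {Γ a F} → All (BangedAbove a) Γ → Γ ⟶ F → Γ ⟶ ! a F
    weak  : ∀ {Γ b F G} → U b → Γ ⟶ G → ! b F ∷ Γ ⟶ G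
    contr : ∀ {Γ b F G} → U b → ! b F ∷ ! b F ∷ Γ ⟶ G → ! b F ∷ Γ ⟶ G

------------------------------------------------------------------------
-- Soft constraints

softSignature : ∀ {c ℓ} → CSemiring c ℓ → SubexpSignature c ℓ ℓ 0ℓ
softSignature 𝒜 = record
  { I          = Carrier
  ; _≈_        = _≈_
  ; _⪯_        = _≤_
  ; isPreorder = ≤-isPreorder
  ; U          = Unary.U
  ; U-upClosed = λ _ _ → _
  }
  where open CSemiring 𝒜

module Constraints {c ℓ f r}
                   (𝒜 : CSemiring c ℓ) (𝒫 : FirstOrderSignature f r) where

  open CSemiring 𝒜 using (Carrier; ⊤)
  open FirstOrderSignature 𝒫 using (PredSym)
  open Syntax Carrier 𝒫

  -- Tensors !ᵃA₁ ⊗ ⋯ ⊗ !ᵃAₙ with n ≥ 1, in any bracketing.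
  data IsBangTensor {n} (a : Carrier) : Formula n → Set (c ⊔ f ⊔ r) where
    one : ∀ {k} (p : PredSym k) ts → IsBangTensor a (! a (atom p ts))
    _⊗_ : ∀ {A B} → IsBangTensor a A → IsBangTensor a B → IsBangTensor a (A ⊗ B)

  data IsConstraint {n} : Formula n → Set (c ⊔ f ⊔ r) where
    𝟏        : IsConstraint 𝟏
    𝟎        : IsConstraint 𝟎
    _⊗_      : ∀ {A B} → IsConstraint A → IsConstraint B → IsConstraint (A ⊗ B)
    ∃′       : ∀ {A : Formula (suc n)} → IsConstraint A → IsConstraint (∃′ A)
    !-atom   : ∀ a {k} (p : PredSym k) ts → IsConstraint (! a (atom p ts))
    !-tensor : ∀ a {A} → IsBangTensor a A → IsConstraint (! a A)

  subst-isBangTensor : ∀ {m n a} {σ : Var → Term n} {ρ : Fin m → Term n} {A} →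
                       IsBangTensor a A → IsBangTensor a (subst σ ρ A)
  subst-isBangTensor (one p ts) = one p _
  subst-isBangTensor (A ⊗ B)    = subst-isBangTensor A ⊗ subst-isBangTensor B

  subst-isConstraint : ∀ {m n} {σ : Var → Term n} {ρ : Fin m → Term n} {A} →
                       IsConstraint A → IsConstraint (subst σ ρ A)
  subst-isConstraint 𝟏               = 𝟏
  subst-isConstraint 𝟎               = 𝟎
  subst-isConstraint (A ⊗ B)         = subst-isConstraint A ⊗ subst-isConstraint B
  subst-isConstraint (∃′ A)          = ∃′ (subst-isConstraint A)
  subst-isConstraint (!-atom a p ts) = !-atom a p _
  subst-isConstraint (!-tensor a A)  = !-tensor a (subst-isBangTensor A)

  𝒞 : Set (c ⊔ f ⊔ r)
  𝒞 = Σ[ A ∈ Formula 0 ] IsConstraint A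

  infixr 8 _⊗ᶜ_
  infixl 10 _[_/_]ᶜ

  𝟏ᶜ 𝟎ᶜ : 𝒞
  𝟏ᶜ = 𝟏 , 𝟏
  𝟎ᶜ = 𝟎 , 𝟎

  _⊗ᶜ_ : 𝒞 → 𝒞 → 𝒞
  (A , p) ⊗ᶜ (B , q) = A ⊗ B , p ⊗ q

  ∃ᶜ : Var → 𝒞 → 𝒞
  ∃ᶜ x (A , p) = ∃[ x ] A , ∃′ (subst-isConstraint p)

  _[_/_]ᶜ : 𝒞 → Var → Var → 𝒞
  (A , p) [ y / x ]ᶜ = A [ y / x ] , subst-isConstraint p

  equation : PredSym 2 → Var → Var → 𝒞
  equation eq x y = _ , !-atom ⊤ eq (free x ∷ free y ∷ [])

  -- The axiom ∀x₁⋯xₙ. (lhs ⊸ rhs).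
  record Axiom : Set (c ⊔ f ⊔ r) where
    field
      vars    : List Var
      lhs rhs : 𝒞
      lhs-fv⊆ : ∀ {x} → x ∈ fv (proj₁ lhs) → x ∈ vars
      rhs-fv⊆ : ∀ {x} → x ∈ fv (proj₁ rhs) → x ∈ vars

    formula : Formula 0
    formula = foldr ∀[_]_ (proj₁ lhs ⊸ proj₁ rhs) vars

record SoftConstraintSystem c ℓ f r : Set (lsuc (c ⊔ ℓ ⊔ f ⊔ r)) where
  field
    𝒜 : CSemiring c ℓ
    𝒫 : FirstOrderSignature f r

  open CSemiring 𝒜 using (Carrier; ⊤)
  open FirstOrderSignature 𝒫 using (PredSym) public
  open Syntax Carrier 𝒫
  open SELL (softSignature 𝒜) 𝒫
  open Constraints 𝒜 𝒫 public

  field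
    Δ : List Axiom

  infix 4 _⊢_ _≤_

  _⊢_ : Rel 𝒞 (c ⊔ ℓ ⊔ f ⊔ r)
  (D , _) ⊢ (C , _) = map (λ δ → ! ⊤ (Axiom.formula δ)) Δ ++ [ D ] ⟶ C

  _≤_ : Rel 𝒞 (c ⊔ ℓ ⊔ f ⊔ r)
  C ≤ D = D ⊢ C

  record IsEqualityTheory (eq : PredSym 2) : Set (c ⊔ ℓ ⊔ f ⊔ r) where
    field
      reflexivity  : ∀ x → 𝟏ᶜ ⊢ equation eq x x
      replacement  : ∀ x y C → equation eq x y ⊗ᶜ C ⊢ C [ y / x ]ᶜ
      replacement′ : ∀ x y C → equation eq x y ⊗ᶜ C [ y / x ]ᶜ ⊢ C

  Diagonals : PredSym 2 → Pred 𝒞 (c ⊔ f ⊔ r)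
  Diagonals eq C = ∃₂ λ x y → C ≡ equation eq x y

------------------------------------------------------------------------
-- Cylindric constraint systems

module _ {c ℓ v} {C : Set c} {V : Set v} (_≤_ : Rel C ℓ) where

  _≣_ : Rel C ℓ
  a ≣ b = a ≤ b × b ≤ a

  -- The lattice ⟨C, ≤, ∨, 𝟏, 𝟎⟩ is given by binary joins and the two bounds.
  -- Binary meets are not asked for: conjunctive-existential constraints need
  -- not have greatest lower bounds modulo an arbitrary set of axioms.
  record IsCylindricConstraintSystem {q}
           (_∨_ : C → C → C) (𝟏 𝟎 : C) (cyl : V → C → C)
           (D : Pred C q) (d : V → V → C) : Set (c ⊔ ℓ ⊔ v ⊔ q) where
    field
      isBoundedJoinSemilattice : IsBoundedJoinSemilattice _≣_ _≤_ _∨_ 𝟏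
      maximum                  : Maximum _≤_ 𝟎

      denumerable : V ↔ ℕ

      E1 : ∀ x a → cyl x a ≤ a
      E2 : ∀ x {a b} → a ≤ b → cyl x a ≤ cyl x b
      E3 : ∀ x a b → cyl x (a ∨ cyl x b) ≣ (cyl x a ∨ cyl x b)
      E4 : ∀ x y a → cyl x (cyl y a) ≣ cyl y (cyl x a)

      diagonal : ∀ x y → D (d x y)
      D1 : ∀ x → d x x ≣ 𝟏
      D2 : ∀ x y z → z ≢ x → z ≢ y → d x y ≣ cyl z (d x z ∨ d z y)
      D3 : ∀ x y a → x ≢ y → a ≤ (d x y ∨ cyl x (a ∨ d x y))

{-# OPTIONS --safe #-}

-- The order is transitive only if cut is admissible in SELL, which is proved
-- semantically, by Okada's phase-space argument.  A formula A is interpreted as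
-- a set ⟦ A ⟧ of contexts closed under the operator `Cl` below, so that
-- [ A ] ∈ ⟦ A ⟧ ⊆ { Γ | Γ ⟶ A }; soundness of the cut-free rules then yields
-- cut.  Quantifiers range over all instances A ⟨ t ⟩ and soundness is proved
-- under an arbitrary substitution σ of the free variables, so that an
-- eigenvariable is handled by updating σ and derivations are never renamed.
-- Given cut, constraints can be weakened and contracted, and the cylindric laws
-- are short derivations.
module Submission where

open import Defs
open import Data.Empty.Polymorphic using (⊥)
open import Data.Fin using (Fin; zero; suc)
open import Data.List using (List; []; _∷_; _++_; [_]; concatMap; foldr; map)
open import Data.List.Membership.Propositional using (_∈_; _∉_)
open import Data.List.Membership.Propositional.Properties using (∈-++⁺ˡ; ∈-++⁺ʳ; ∈-++⁻)
open import Data.List.Properties using (++-assoc; ++-identityʳ)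
open import Data.List.Relation.Binary.Permutation.Propositional
  using (_↭_; ↭-reflexive; ↭-sym; ↭-trans; refl; prep; swap; trans)
open import Data.List.Relation.Binary.Permutation.Propositional.Properties
  using (++-comm; ++⁺ˡ; ++⁺ʳ; shift; shifts)
open import Data.List.Relation.Unary.All as All using (All; []; _∷_)
import Data.List.Relation.Unary.All.Properties as All
open import Data.List.Relation.Unary.Any using (here; there)
open import Data.Nat as ℕ using (ℕ; suc; _≟_)
open import Data.Nat.ListAction using (sum)
open import Data.Nat.Properties using (<-irrefl; m≤m+n; m≤n+m; ≤-trans)
open import Data.Product using (∃; ∃₂; _×_; _,_; proj₁)
open import Data.Sum as Sum using (_⊎_; inj₁; inj₂)
open import Data.Unit.Polymorphic using () renaming (⊤ to Unit)
open import Data.Vec using (Vec; []; _∷_)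
open import Function using (_∘_)
open import Function.Construct.Identity using (↔-id)
open import Level using (Lift; _⊔_) renaming (lift to lifted)
open import Relation.Binary using (IsPreorder)
open import Relation.Binary.PropositionalEquality as ≡
  using (_≡_; _≢_; refl; cong; cong₂)
open import Relation.Nullary using (contradiction; yes; no)
open import Relation.Unary using (Pred)

-- Simultaneous substitution and free variables in locally nameless syntax.

module Substitution {i f r} (I : Set i) (𝒫 : FirstOrderSignature f r) where

  open Syntax I 𝒫

  private variable
    k l m n : ℕ
    σ τ υ   : Var → Term n
    ρ θ κ   : Fin m → Term n

  mutual
    -- The composite is described by its values `υ` and `κ`, and agreement on names is asked only
    -- where they occur in `t`. Instances, renamings and updates at a fresh variable then all follow
    -- from one lemma, without function extensionality.
    substT-substT : (t : Term l) →
      (∀ {x} → x ∈ fvT t → substT τ θ (σ x) ≡ υ x) → (∀ j → substT τ θ (ρ j) ≡ κ j) →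
      substT τ θ (substT σ ρ t) ≡ substT υ κ t
    substT-substT (free x)   p q = p (here refl)
    substT-substT (bound j)  p q = q j
    substT-substT (fun g ts) p q = cong (fun g) (substTs-substTs ts p q)

    substTs-substTs : (ts : Vec (Term l) k) →
      (∀ {x} → x ∈ fvTs ts → substT τ θ (σ x) ≡ υ x) → (∀ j → substT τ θ (ρ j) ≡ κ j) →
      substTs τ θ (substTs σ ρ ts) ≡ substTs υ κ ts
    substTs-substTs []       p q = refl
    substTs-substTs (t ∷ ts) p q =
      cong₂ _∷_ (substT-substT t (p ∘ ∈-++⁺ˡ) q)
                (substTs-substTs ts (p ∘ ∈-++⁺ʳ (fvT t)) q)

  substT-lift-weaken : (t : Term m) →
    substT (weaken ∘ τ) (lift θ) (weaken t) ≡ weaken (substT τ θ t)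
  substT-lift-weaken t =
    ≡.trans (substT-substT t (λ _ → refl) (λ _ → refl))
          (≡.sym (substT-substT t (λ _ → refl) (λ _ → refl)))

  lift-≗ : (∀ j → substT τ θ (ρ j) ≡ κ j) →
           ∀ j → substT (weaken ∘ τ) (lift θ) (lift ρ j) ≡ lift κ j
  lift-≗         q zero    = refl
  lift-≗ {ρ = ρ} q (suc j) = ≡.trans (substT-lift-weaken (ρ j)) (cong weaken (q j))

  subst-subst : (A : Formula l) →
    (∀ {x} → x ∈ fv A → substT τ θ (σ x) ≡ υ x) → (∀ j → substT τ θ (ρ j) ≡ κ j) →
    subst τ θ (subst σ ρ A) ≡ subst υ κ A
  subst-subst (atom p ts) h q = cong (atom p) (substTs-substTs ts h q)
  subst-subst 𝟏           h q = refl
  subst-subst 𝟎           h q = refl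
  subst-subst ⊤′          h q = refl
  subst-subst (A ⊗ B)     h q = cong₂ _⊗_ (subst-subst A (h ∘ ∈-++⁺ˡ) q)
                                          (subst-subst B (h ∘ ∈-++⁺ʳ (fv A)) q)
  subst-subst (A ⊸ B)     h q = cong₂ _⊸_ (subst-subst A (h ∘ ∈-++⁺ˡ) q)
                                          (subst-subst B (h ∘ ∈-++⁺ʳ (fv A)) q)
  subst-subst (A & B)     h q = cong₂ _&_ (subst-subst A (h ∘ ∈-++⁺ˡ) q)
                                          (subst-subst B (h ∘ ∈-++⁺ʳ (fv A)) q)
  subst-subst {σ = σ} (∃′ A) h q = cong ∃′ (subst-subst A
    (λ {x} x∈A → ≡.trans (substT-lift-weaken (σ x)) (cong weaken (h x∈A))) (lift-≗ q))
  subst-subst {σ = σ} (∀′ A) h q = cong ∀′ (subst-subst A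
    (λ {x} x∈A → ≡.trans (substT-lift-weaken (σ x)) (cong weaken (h x∈A))) (lift-≗ q))
  subst-subst (! a A)     h q = cong (! a) (subst-subst A h q)

  mutual
    substT-id : (t : Term n) → (∀ {x} → x ∈ fvT t → σ x ≡ free x) →
                (∀ j → ρ j ≡ bound j) → substT σ ρ t ≡ t
    substT-id (free x)   p q = p (here refl)
    substT-id (bound j)  p q = q j
    substT-id (fun g ts) p q = cong (fun g) (substTs-id ts p q)

    substTs-id : (ts : Vec (Term n) k) → (∀ {x} → x ∈ fvTs ts → σ x ≡ free x) →
                 (∀ j → ρ j ≡ bound j) → substTs σ ρ ts ≡ ts
    substTs-id []       p q = refl
    substTs-id (t ∷ ts) p q =
      cong₂ _∷_ (substT-id t (p ∘ ∈-++⁺ˡ) q) (substTs-id ts (p ∘ ∈-++⁺ʳ (fvT t)) q)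

  lift-bound : (∀ j → ρ j ≡ bound {n} j) → ∀ j → lift ρ j ≡ bound j
  lift-bound q zero    = refl
  lift-bound q (suc j) = cong weaken (q j)

  subst-id : (A : Formula n) → (∀ {x} → x ∈ fv A → σ x ≡ free x) →
             (∀ j → ρ j ≡ bound j) → subst σ ρ A ≡ A
  subst-id (atom p ts) h q = cong (atom p) (substTs-id ts h q)
  subst-id 𝟏           h q = refl
  subst-id 𝟎           h q = refl
  subst-id ⊤′          h q = refl
  subst-id (A ⊗ B)     h q =
    cong₂ _⊗_ (subst-id A (h ∘ ∈-++⁺ˡ) q) (subst-id B (h ∘ ∈-++⁺ʳ (fv A)) q)
  subst-id (A ⊸ B)     h q =
    cong₂ _⊸_ (subst-id A (h ∘ ∈-++⁺ˡ) q) (subst-id B (h ∘ ∈-++⁺ʳ (fv A)) q)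
  subst-id (A & B)     h q =
    cong₂ _&_ (subst-id A (h ∘ ∈-++⁺ˡ) q) (subst-id B (h ∘ ∈-++⁺ʳ (fv A)) q)
  subst-id (∃′ A)      h q = cong ∃′ (subst-id A (cong weaken ∘ h) (lift-bound q))
  subst-id (∀′ A)      h q = cong ∀′ (subst-id A (cong weaken ∘ h) (lift-bound q))
  subst-id (! a A)     h q = cong (! a) (subst-id A h q)

  -- Inserting the identity substitution in front makes this a case of `subst-subst`.
  subst-cong : (A : Formula m) → (∀ {x} → x ∈ fv A → σ x ≡ υ x) → (∀ j → ρ j ≡ κ j) →
               subst σ ρ A ≡ subst υ κ A
  subst-cong {σ = σ} {ρ = ρ} A h q =
    ≡.trans (cong (subst σ ρ) (≡.sym (subst-id A (λ _ → refl) (λ _ → refl))))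
          (subst-subst A h q)

  -- Instantiation at `t` undoes the weakening performed under the binder, so substituting under a
  -- quantifier and then opening it amounts to one substitution that sends the new index to `t`.
  subst-lift-⟨⟩ : (A : Formula (suc m)) {t : Term 0} → κ zero ≡ t →
                  (∀ {x} → x ∈ fv A → σ x ≡ υ x) → (∀ j → ρ j ≡ κ (suc j)) →
                  subst (weaken ∘ σ) (lift ρ) A ⟨ t ⟩ ≡ subst υ κ A
  subst-lift-⟨⟩ {κ = κ} {σ = σ} {υ = υ} {ρ = ρ} A {t} κ₀≡t h q =
    subst-subst A (λ {x} x∈A → ≡.trans (instance-weaken (σ x)) (h x∈A))
      λ { zero → ≡.sym κ₀≡t ; (suc j) → ≡.trans (instance-weaken (ρ j)) (q j) }
    where
    instance-weaken : ∀ s → substT free (λ _ → t) (weaken s) ≡ s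
    instance-weaken s = ≡.trans (substT-substT {κ = bound} s (λ _ → refl) λ ())
                              (substT-id s (λ _ → refl) λ ())

  single-≡ : ∀ x (t : Term n) → single x t x ≡ t
  single-≡ x t with x ≟ x
  ... | yes _  = refl
  ... | no x≢x = contradiction refl x≢x

  single-≢ : ∀ {x z} (t : Term n) → z ≢ x → single x t z ≡ free z
  single-≢ {x = x} {z} t z≢x with z ≟ x
  ... | yes z≡x = contradiction z≡x z≢x
  ... | no _    = refl

  substT-single : ∀ x (s : Term m) z →
                  substT free ρ (single x s z) ≡ single x (substT free ρ s) z
  substT-single x s z with z ≟ x
  ... | yes _ = refl
  ... | no _  = refl

  single-free : ∀ x z → single {n} x (free x) z ≡ free z
  single-free x z with z ≟ x
  ... | yes refl = refl
  ... | no _     = refl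

  abstr-⟨⟩ : ∀ x A y → abstr x A ⟨ free y ⟩ ≡ A [ y / x ]
  abstr-⟨⟩ x A y = subst-subst A (λ {z} _ → substT-single x (bound zero) z) λ ()

  abstr-⟨free⟩ : ∀ x A → abstr x A ⟨ free x ⟩ ≡ A
  abstr-⟨free⟩ x A =
    ≡.trans (abstr-⟨⟩ x A x) (subst-id A (λ {z} _ → single-free x z) λ ())

  mutual
    fvT-substT : ∀ {y} (t : Term m) → y ∈ fvT (substT σ ρ t) →
                 (∃ λ x → x ∈ fvT t × y ∈ fvT (σ x)) ⊎ ∃ λ j → y ∈ fvT (ρ j)
    fvT-substT (free x)   y∈ = inj₁ (x , here refl , y∈)
    fvT-substT (bound j)  y∈ = inj₂ (j , y∈)
    fvT-substT (fun g ts) y∈ = fvTs-substTs ts y∈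

    fvTs-substTs : ∀ {y} (ts : Vec (Term m) k) → y ∈ fvTs (substTs σ ρ ts) →
                   (∃ λ x → x ∈ fvTs ts × y ∈ fvT (σ x)) ⊎ ∃ λ j → y ∈ fvT (ρ j)
    fvTs-substTs {σ = σ} {ρ = ρ} (t ∷ ts) y∈ with ∈-++⁻ (fvT (substT σ ρ t)) y∈
    ... | inj₁ y∈t  = Sum.map₁ (λ (x , x∈ , p) → x , ∈-++⁺ˡ x∈ , p) (fvT-substT t y∈t)
    ... | inj₂ y∈ts = Sum.map₁ (λ (x , x∈ , p) → x , ∈-++⁺ʳ (fvT t) x∈ , p)
                               (fvTs-substTs ts y∈ts)

  fvT-weaken : ∀ {y} (t : Term m) → y ∈ fvT (weaken t) → y ∈ fvT t
  fvT-weaken t y∈ with fvT-substT t y∈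
  ... | inj₁ (x , x∈ , here refl) = x∈

  fvT-lift : ∀ {y} (ρ : Fin m → Term n) → (∃ λ j → y ∈ fvT (lift ρ j)) →
             ∃ λ j → y ∈ fvT (ρ j)
  fvT-lift ρ (suc j , y∈) = j , fvT-weaken (ρ j) y∈

  fv-subst : ∀ {y} (A : Formula m) → y ∈ fv (subst σ ρ A) →
             (∃ λ x → x ∈ fv A × y ∈ fvT (σ x)) ⊎ ∃ λ j → y ∈ fvT (ρ j)
  fv-subst-++ : ∀ {y} (A B : Formula m) → y ∈ fv (subst σ ρ A) ++ fv (subst σ ρ B) →
                (∃ λ x → x ∈ fv A ++ fv B × y ∈ fvT (σ x)) ⊎ ∃ λ j → y ∈ fvT (ρ j)
  fv-subst-lift : ∀ {y} (A : Formula (suc m)) →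
                  y ∈ fv (subst (weaken ∘ σ) (lift ρ) A) →
                  (∃ λ x → x ∈ fv A × y ∈ fvT (σ x)) ⊎ ∃ λ j → y ∈ fvT (ρ j)

  fv-subst (atom p ts) y∈ = fvTs-substTs ts y∈
  fv-subst (A ⊗ B)     y∈ = fv-subst-++ A B y∈
  fv-subst (A ⊸ B)     y∈ = fv-subst-++ A B y∈
  fv-subst (A & B)     y∈ = fv-subst-++ A B y∈
  fv-subst {σ = σ} (∃′ A) y∈ = fv-subst-lift {σ = σ} A y∈
  fv-subst {σ = σ} (∀′ A) y∈ = fv-subst-lift {σ = σ} A y∈
  fv-subst (! a A)     y∈ = fv-subst A y∈

  fv-subst-++ {σ = σ} {ρ = ρ} A B y∈ with ∈-++⁻ (fv (subst σ ρ A)) y∈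
  ... | inj₁ y∈A = Sum.map₁ (λ (x , x∈ , p) → x , ∈-++⁺ˡ x∈ , p) (fv-subst A y∈A)
  ... | inj₂ y∈B = Sum.map₁ (λ (x , x∈ , p) → x , ∈-++⁺ʳ (fv A) x∈ , p) (fv-subst B y∈B)

  fv-subst-lift {σ = σ} {ρ = ρ} A y∈ =
    Sum.map (λ (x , x∈ , p) → x , x∈ , fvT-weaken (σ x) p) (fvT-lift ρ) (fv-subst A y∈)

  fv-abstr : ∀ {x y} A → y ∈ fv (abstr x A) → y ∈ fv A × y ≢ x
  fv-abstr {x} A y∈ with fv-subst A y∈
  ... | inj₁ (z , z∈ , p) with z ≟ x | p
  ...   | no z≢x | here refl = z∈ , z≢x

  #-abstr : ∀ x A → x # abstr x A
  #-abstr x A x∈ with fv-abstr A x∈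
  ... | _ , x≢x = x≢x refl

∈⇒≤sum : ∀ {x xs} → x ∈ xs → x ℕ.≤ sum xs
∈⇒≤sum {xs = y ∷ ys} (here refl) = m≤m+n y (sum ys)
∈⇒≤sum {xs = y ∷ ys} (there x∈) = ≤-trans (∈⇒≤sum x∈) (m≤n+m (sum ys) y)

-- The sum of a list bounds each of its members, so its successor does not occur.
fresh : (xs : List ℕ) → ∃ λ x → x ∉ xs
fresh xs = suc (sum xs) , λ x∈ → <-irrefl refl (∈⇒≤sum x∈)

-- Phase-space facts and their closure operator.

module CutAdmissibility {i ℓ₁ ℓ₂ u f r}
  (S : SubexpSignature i ℓ₁ ℓ₂ u) (𝒫 : FirstOrderSignature f r) where

  open SubexpSignature S using (I; _⪯_; U; isPreorder; U-upClosed)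
  open Syntax I 𝒫
  open SELL S 𝒫
  open Substitution I 𝒫

  Context : Set (i ⊔ f ⊔ r)
  Context = List (Formula 0)

  Fact : Set _
  Fact = Pred Context (i ⊔ ℓ₂ ⊔ u ⊔ f ⊔ r)

  private variable
    X Y     : Fact
    Γ Γ′ Θ Ξ : Context
    A B G   : Formula 0
    a       : I

  fresh-context : (Γ : Context) (xs : List Var) → ∃ λ x → All (x #_) Γ × x ∉ xs
  fresh-context Γ xs with fresh (concatMap fv Γ ++ xs)
  ... | x , x∉ = x , go Γ (x∉ ∘ ∈-++⁺ˡ) , x∉ ∘ ∈-++⁺ʳ (concatMap fv Γ)
    where
    go : ∀ Γ → x ∉ concatMap fv Γ → All (x #_) Γ
    go []      x∉ = []
    go (A ∷ Γ) x∉ = (x∉ ∘ ∈-++⁺ˡ) ∷ go Γ (x∉ ∘ ∈-++⁺ʳ (fv A))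

  cast : Γ ≡ Γ′ → Γ ⟶ G → Γ′ ⟶ G
  cast = exch ∘ ↭-reflexive

  -- This is the double orthogonal of phase semantics. A test is a pair `Θ`, `G`, passed by a
  -- context that proves `G` together with `Θ`; the closure holds the contexts passing every test
  -- that all of `X` passes.
  Cl : Fact → Fact
  Cl X Γ = ∀ {Θ G} → (∀ {Γ′} → X Γ′ → Γ′ ++ Θ ⟶ G) → Γ ++ Θ ⟶ G

  Closed : Fact → Set _
  Closed X = ∀ {Γ} → Cl X Γ → X Γ

  Cl-unit : X Γ → Cl X Γ
  Cl-unit x h = h x

  Cl-closed : Closed (Cl X)
  Cl-closed c h = c λ c′ → c′ h

  -- When the goal is a closed fact, a member of a closure may be assumed to be a generator, even
  -- beside a further context `Θ`.
  bind : Closed Y → Cl X Γ → (∀ {Γ′} → X Γ′ → Y (Γ′ ++ Θ)) → Y (Γ ++ Θ)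
  bind {Γ = Γ} {Θ = Θ} closed c k = closed λ {Θ′} h →
    cast (≡.sym (++-assoc Γ Θ Θ′))
      (c λ {Γ′} x → cast (++-assoc Γ′ Θ Θ′) (h (k x)))

  -- A closed fact is determined by the tests its members pass, so it is stable under any left
  -- inference that is uniform in `Θ` and `G`.
  adapt : Closed Y → (∀ {Θ G} → Γ ++ Θ ⟶ G → Γ′ ++ Θ ⟶ G) → Y Γ → Y Γ′
  adapt closed rule y = closed λ h → rule (h y)

  exchange : Closed Y → Γ ↭ Γ′ → Y Γ → Y Γ′
  exchange closed p = adapt closed λ {Θ} → exch (++⁺ʳ Θ p)

  rotate : (Γ Ξ Θ : Context) → (Γ ++ Ξ) ++ Θ ↭ Ξ ++ Γ ++ Θ
  rotate Γ Ξ Θ = ↭-trans (++⁺ʳ Θ (++-comm Γ Ξ)) (↭-reflexive (++-assoc Ξ Γ Θ))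

  -- The prefix `Γ` is moved into the test context. This gives closure of implications and lets
  -- `promote` recurse behind a context already treated.
  shift-closed : ∀ Γ → Closed Y → Closed (λ Ξ → Y (Γ ++ Ξ))
  shift-closed Γ closed {Ξ} c = closed λ {Θ} h →
    exch (↭-sym (rotate Γ Ξ Θ)) (c λ {Γ′} y → exch (rotate Γ Γ′ Θ) (h y))

  -- Interpretation of formulas as closed facts.

  data Skeleton : Set where
    leaf              : Skeleton
    node              : Skeleton → Skeleton → Skeleton
    quantifier modal  : Skeleton → Skeleton

  skeleton : ∀ {n} → Formula n → Skeleton
  skeleton (atom _ _) = leaf
  skeleton 𝟏          = leaf
  skeleton 𝟎          = leaf
  skeleton ⊤′         = leaf
  skeleton (A ⊗ B)    = node (skeleton A) (skeleton B)
  skeleton (A ⊸ B)    = node (skeleton A) (skeleton B)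
  skeleton (A & B)    = node (skeleton A) (skeleton B)
  skeleton (∃′ A)     = quantifier (skeleton A)
  skeleton (∀′ A)     = quantifier (skeleton A)
  skeleton (! _ A)    = modal (skeleton A)

  skeleton-subst : ∀ {m n} {σ : Var → Term n} {ρ : Fin m → Term n} A →
                   skeleton (subst σ ρ A) ≡ skeleton A
  skeleton-subst (atom p ts) = refl
  skeleton-subst 𝟏           = refl
  skeleton-subst 𝟎           = refl
  skeleton-subst ⊤′          = refl
  skeleton-subst (A ⊗ B)     = cong₂ node (skeleton-subst A) (skeleton-subst B)
  skeleton-subst (A ⊸ B)     = cong₂ node (skeleton-subst A) (skeleton-subst B)
  skeleton-subst (A & B)     = cong₂ node (skeleton-subst A) (skeleton-subst B)
  skeleton-subst (∃′ A)      = cong quantifier (skeleton-subst A)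
  skeleton-subst (∀′ A)      = cong quantifier (skeleton-subst A)
  skeleton-subst (! a A)     = cong modal (skeleton-subst A)

  -- A ⟨ t ⟩ is not a subformula of ∃′ A, but it has the skeleton of A, whence the
  -- recursion on skeletons.  The last clause is meant for atoms; its value is junk
  -- when the skeleton is not that of A.
  ⟦_⟧ₛ : Skeleton → Formula 0 → Fact
  ⟦ leaf         ⟧ₛ 𝟏       = Cl λ Γ → Lift (ℓ₂ ⊔ u) (Γ ≡ [])
  ⟦ leaf         ⟧ₛ 𝟎       = Cl λ _ → ⊥
  ⟦ leaf         ⟧ₛ ⊤′      = λ _ → Unit
  ⟦ node s t     ⟧ₛ (A ⊗ B) =
    Cl λ Ξ → ∃₂ λ Γ Θ → Ξ ≡ Γ ++ Θ × ⟦ s ⟧ₛ A Γ × ⟦ t ⟧ₛ B Θ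
  ⟦ node s t     ⟧ₛ (A ⊸ B) = λ Θ → ∀ {Γ} → ⟦ s ⟧ₛ A Γ → ⟦ t ⟧ₛ B (Γ ++ Θ)
  ⟦ node s t     ⟧ₛ (A & B) = λ Γ → ⟦ s ⟧ₛ A Γ × ⟦ t ⟧ₛ B Γ
  ⟦ quantifier s ⟧ₛ (∃′ A)  = Cl λ Γ → ∃ λ t → ⟦ s ⟧ₛ (A ⟨ t ⟩) Γ
  ⟦ quantifier s ⟧ₛ (∀′ A)  = λ Γ → ∀ t → ⟦ s ⟧ₛ (A ⟨ t ⟩) Γ
  ⟦ modal s      ⟧ₛ (! a A) = Cl λ Γ → All (BangedAbove a) Γ × ⟦ s ⟧ₛ A Γ
  ⟦ _            ⟧ₛ A       = λ Γ → Γ ⟶ A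

  ⟦_⟧ : Formula 0 → Fact
  ⟦ A ⟧ = ⟦ skeleton A ⟧ₛ A

  from-instance : ∀ A {t} → ⟦ skeleton A ⟧ₛ (A ⟨ t ⟩) Γ → ⟦ A ⟨ t ⟩ ⟧ Γ
  from-instance A = ≡.subst (λ s → ⟦ s ⟧ₛ (A ⟨ _ ⟩) _) (≡.sym (skeleton-subst A))

  to-instance : ∀ A {t} → ⟦ A ⟨ t ⟩ ⟧ Γ → ⟦ skeleton A ⟧ₛ (A ⟨ t ⟩) Γ
  to-instance A = ≡.subst (λ s → ⟦ s ⟧ₛ (A ⟨ _ ⟩) _) (skeleton-subst A)

  transport : A ≡ B → ⟦ A ⟧ Γ → ⟦ B ⟧ Γ
  transport refl a = a

  ⟶-closed : Closed (_⟶ G)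
  ⟶-closed {Γ = Γ} c = cast (++-identityʳ Γ)
    (c λ {Γ′} d → cast (≡.sym (++-identityʳ Γ′)) d)

  nodeˡ : ∀ {s s′ t t′} → node s t ≡ node s′ t′ → s ≡ s′
  nodeˡ refl = refl

  nodeʳ : ∀ {s s′ t t′} → node s t ≡ node s′ t′ → t ≡ t′
  nodeʳ refl = refl

  skeleton-⟨⟩ : ∀ A {t s} → quantifier (skeleton A) ≡ quantifier s →
                skeleton (A ⟨ t ⟩) ≡ s
  skeleton-⟨⟩ A refl = skeleton-subst A

  modal⁻ : ∀ {s s′} → modal s ≡ modal s′ → s ≡ s′
  modal⁻ refl = refl

  -- The equation rules out the junk values, while recursion on `s` remains structural when `A` is
  -- replaced by an instance. `reflect` and `reify` have the same form for the same reason.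
  ⟦⟧ₛ-closed : ∀ s A → skeleton A ≡ s → Closed (⟦ s ⟧ₛ A)
  ⟦⟧ₛ-closed leaf           (atom p ts) refl c = ⟶-closed c
  ⟦⟧ₛ-closed leaf           𝟏           refl c = Cl-closed c
  ⟦⟧ₛ-closed leaf           𝟎           refl c = Cl-closed c
  ⟦⟧ₛ-closed leaf           ⊤′          refl c = _
  ⟦⟧ₛ-closed (node s t)     (A ⊗ B)     eq c = Cl-closed c
  ⟦⟧ₛ-closed (node s t)     (A ⊸ B)     eq c {Γ} a =
    shift-closed Γ (⟦⟧ₛ-closed t B (nodeʳ eq)) λ h → c λ f → h (f a)
  ⟦⟧ₛ-closed (node s t)     (A & B)     eq c =
    ⟦⟧ₛ-closed s A (nodeˡ eq) (λ h → c λ (a , _) → h a) ,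
    ⟦⟧ₛ-closed t B (nodeʳ eq) (λ h → c λ (_ , b) → h b)
  ⟦⟧ₛ-closed (quantifier s) (∃′ A)      eq c = Cl-closed c
  ⟦⟧ₛ-closed (quantifier s) (∀′ A)      eq c t =
    ⟦⟧ₛ-closed s (A ⟨ t ⟩) (skeleton-⟨⟩ A eq) λ h → c λ f → h (f t)
  ⟦⟧ₛ-closed (modal s)      (! a A)     eq c = Cl-closed c

  ⟦⟧-closed : ∀ A → Closed ⟦ A ⟧
  ⟦⟧-closed A = ⟦⟧ₛ-closed (skeleton A) A refl

  mutual
    -- Left rules put the singleton context into the fact, and right rules in `reify` extract a
    -- derivation from it. The two are mutual because implication is contravariant in its premise.
    reflect : ∀ s A → skeleton A ≡ s → ⟦ s ⟧ₛ A [ A ]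
    reflect leaf           (atom p ts) refl = init
    reflect leaf           𝟏           refl h = 𝟏L (h (lifted refl))
    reflect leaf           𝟎           refl h = 𝟎L
    reflect leaf           ⊤′          refl = _
    reflect (node s t)     (A ⊗ B)     eq h =
      ⊗L (h ([ A ] , [ B ] , refl , reflect s A (nodeˡ eq) , reflect t B (nodeʳ eq)))
    reflect (node s t)     (A ⊸ B)     eq {Γ} a =
      adapt (⟦⟧ₛ-closed t B (nodeʳ eq))
        (λ {Θ} d → exch (↭-sym (rotate Γ [ A ⊸ B ] Θ)) (⊸L (reify s A (nodeˡ eq) a) d))
        (reflect t B (nodeʳ eq))
    reflect (node s t)     (A & B)     eq =
      adapt (⟦⟧ₛ-closed s A (nodeˡ eq)) &L₁ (reflect s A (nodeˡ eq)) ,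
      adapt (⟦⟧ₛ-closed t B (nodeʳ eq)) &L₂ (reflect t B (nodeʳ eq))
    -- The test `Θ`, `G` is known before the witness is chosen, so an eigenvariable fresh for it can
    -- be taken as the witness.
    reflect (quantifier s) (∃′ A)      eq {Θ} {G} h with fresh-context Θ (fv A ++ fv G)
    ... | x , x#Θ , x# =
      ∃L x (x# ∘ ∈-++⁺ˡ) x#Θ (x# ∘ ∈-++⁺ʳ (fv A))
        (h (free x , reflect s (A ⟨ free x ⟩) (skeleton-⟨⟩ A eq)))
    reflect (quantifier s) (∀′ A)      eq t =
      adapt (⟦⟧ₛ-closed s (A ⟨ t ⟩) (skeleton-⟨⟩ A eq)) (∀L t)
        (reflect s (A ⟨ t ⟩) (skeleton-⟨⟩ A eq))
    -- The singleton context is itself a generator: it is banged above `a` by reflexivity and lies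
    -- in the fact of `A` by dereliction.
    reflect (modal s)      (! a A)     eq = Cl-unit
      ( banged (IsPreorder.refl isPreorder) ∷ []
      , adapt (⟦⟧ₛ-closed s A (modal⁻ eq)) der (reflect s A (modal⁻ eq)) )

    reify : ∀ s A → skeleton A ≡ s → ⟦ s ⟧ₛ A Γ → Γ ⟶ A
    reify leaf           (atom p ts) refl d = d
    reify leaf           𝟏           refl c = ⟶-closed λ h → c λ { (lifted refl) → h 𝟏R }
    reify leaf           𝟎           refl c = ⟶-closed λ h → c λ ()
    reify leaf           ⊤′          refl _ = ⊤R
    reify (node s t)     (A ⊗ B)     eq c = ⟶-closed λ h →
      c λ { (_ , _ , refl , a , b) →
        h (⊗R (reify s A (nodeˡ eq) a) (reify t B (nodeʳ eq) b)) }
    reify (node s t)     (A ⊸ B)     eq f =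
      ⊸R (reify t B (nodeʳ eq) (f (reflect s A (nodeˡ eq))))
    reify (node s t)     (A & B)     eq (a , b) =
      &R (reify s A (nodeˡ eq) a) (reify t B (nodeʳ eq) b)
    reify (quantifier s) (∃′ A)      eq c = ⟶-closed λ h →
      c λ (t , a) → h (∃R t (reify s (A ⟨ t ⟩) (skeleton-⟨⟩ A eq) a))
    reify {Γ = Γ} (quantifier s) (∀′ A) eq f with fresh-context Γ (fv A)
    ... | x , x#Γ , x#A =
      ∀R x x#A x#Γ (reify s (A ⟨ free x ⟩) (skeleton-⟨⟩ A eq) (f (free x)))
    reify (modal s)      (! a A)     eq c = ⟶-closed λ h →
      c λ (bs , a) → h (prom bs (reify s A (modal⁻ eq) a))

  -- Soundness of the rules, and cut.

  bangedAbove-trans : ∀ {a b} → a ⪯ b → BangedAbove b A → BangedAbove a A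
  bangedAbove-trans a⪯b (banged b⪯c) = banged (IsPreorder.trans isPreorder a⪯b b⪯c)

  -- Upward closure of `U` makes every formula of `Γ` subject to the structural rules.
  weaken-banged : U a → All (BangedAbove a) Γ → Θ ⟶ G → Γ ++ Θ ⟶ G
  weaken-banged Ua []                 d = d
  weaken-banged Ua (banged a⪯b ∷ bs) d =
    weak (U-upClosed a⪯b Ua) (weaken-banged Ua bs d)

  contract-banged : U a → All (BangedAbove a) Γ → Γ ++ Γ ++ Θ ⟶ G → Γ ++ Θ ⟶ G
  contract-banged Ua []                 d = d
  contract-banged {Γ = A ∷ Γ} {Θ = Θ} Ua (banged a⪯b ∷ bs) d =
    exch (shift A Γ Θ) (contract-banged Ua bs (exch (↭-sym
      (↭-trans (++⁺ˡ Γ (shift A Γ Θ)) (shift A Γ (Γ ++ Θ))))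
      (contr (U-upClosed a⪯b Ua) (exch (prep A (shift A Γ (Γ ++ Θ))) d))))

  infix 30 _·_
  _·_ : (Var → Term 0) → Formula 0 → Formula 0
  σ · A = subst σ (λ ()) A

  private variable
    σ : Var → Term 0

  -- The realising context is a concatenation with one block per formula. No closure is taken over
  -- the whole, so each rule can reach its principal block directly.
  data Instances (σ : Var → Term 0) : Context → Fact where
    []  : Instances σ [] []
    _∷_ : ⟦ σ · A ⟧ Ξ → Instances σ Γ Θ → Instances σ (A ∷ Γ) (Ξ ++ Θ)

  split : ∀ Γ → Instances σ (Γ ++ Γ′) Ξ →
          ∃₂ λ Ξ₁ Ξ₂ → Ξ ≡ Ξ₁ ++ Ξ₂ × Instances σ Γ Ξ₁ × Instances σ Γ′ Ξ₂
  split []      is = [] , _ , refl , [] , is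
  split (A ∷ Γ) (_∷_ {Ξ = Ξ} i is) with split Γ is
  ... | Ξ₁ , Ξ₂ , refl , is₁ , is₂ =
    Ξ ++ Ξ₁ , Ξ₂ , ≡.sym (++-assoc Ξ Ξ₁ Ξ₂) , i ∷ is₁ , is₂

  permute : Γ ↭ Γ′ → Instances σ Γ Ξ → ∃ λ Ξ′ → Ξ′ ↭ Ξ × Instances σ Γ′ Ξ′
  permute refl is = _ , refl , is
  permute (prep A p) (_∷_ {Ξ = Ξ} i is) with permute p is
  ... | Ξ′ , q , is′ = Ξ ++ Ξ′ , ++⁺ˡ Ξ q , i ∷ is′
  permute (swap A B p) (_∷_ {Ξ = Ξ₁} i (_∷_ {Ξ = Ξ₂} j is)) with permute p is
  ... | Ξ′ , q , is′ =
    Ξ₂ ++ Ξ₁ ++ Ξ′ , ↭-trans (shifts Ξ₂ Ξ₁) (++⁺ˡ Ξ₁ (++⁺ˡ Ξ₂ q)) , j ∷ i ∷ is′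
  permute (trans p q) is with permute p is
  ... | _ , p′ , is′ with permute q is′
  ...   | Ξ″ , q′ , is″ = Ξ″ , ↭-trans q′ p′ , is″

  -- Promotion needs a realising context made of banged formulas, whereas each block is only in the
  -- closure of such contexts. The closures are opened one after another, and transitivity brings
  -- every label above `a`.
  promote : Closed Y → All (BangedAbove a) Γ → Instances σ Γ Ξ →
            (∀ {Ξ} → All (BangedAbove a) Ξ → Instances σ Γ Ξ → Y Ξ) → Y Ξ
  promote closed [] [] k = k [] []
  promote closed (banged a⪯b ∷ bs) (i ∷ is) k =
    bind closed i λ {Ξ} (bs′ , f) → promote (shift-closed Ξ closed) bs is λ bs″ is′ →
      k (All.++⁺ (All.map (bangedAbove-trans a⪯b) bs′) bs″) (Cl-unit (bs′ , f) ∷ is′)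

  infixl 31 _[_↦_]
  _[_↦_] : (Var → Term 0) → Var → Term 0 → Var → Term 0
  _[_↦_] σ x t y with y ≟ x
  ... | yes _ = t
  ... | no _  = σ y

  ↦-≡ : ∀ σ x t → (σ [ x ↦ t ]) x ≡ t
  ↦-≡ σ x t with x ≟ x
  ... | yes _  = refl
  ... | no x≢x = contradiction refl x≢x

  ↦-# : ∀ {n x t y} (A : Formula n) → x # A → y ∈ fv A → (σ [ x ↦ t ]) y ≡ σ y
  ↦-# {x = x} {y = y} A x#A y∈A with y ≟ x
  ... | yes refl = contradiction y∈A x#A
  ... | no _     = refl

  ·-update : ∀ {x t} A → x # A → σ [ x ↦ t ] · A ≡ σ · A
  ·-update A x#A = subst-cong A (↦-# A x#A) λ ()

  Instances-update : ∀ {x t} → All (x #_) Γ → Instances σ Γ Ξ →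
                     Instances (σ [ x ↦ t ]) Γ Ξ
  Instances-update [] [] = []
  Instances-update {Ξ = Ξ} (_∷_ {x = A} x#A x#Γ) (i ∷ is) =
    transport (≡.sym (·-update A x#A)) i ∷ Instances-update x#Γ is

  ·-⟨⟩ : ∀ A {t} → σ · (A ⟨ t ⟩) ≡ subst (weaken ∘ σ) (lift λ ()) A ⟨ substT σ (λ ()) t ⟩
  ·-⟨⟩ A = ≡.trans (subst-subst A (λ _ → refl) λ _ → refl)
                   (≡.sym (subst-lift-⟨⟩ A refl (λ _ → refl) λ ()))

  -- Freshness of the eigenvariable lets the premise of `∃L` or `∀R`, read under the updated
  -- substitution, stand for the instance at an arbitrary `t`.
  ·-update-⟨⟩ : ∀ A {x t} → x # A →
                σ [ x ↦ t ] · (A ⟨ free x ⟩) ≡ subst (weaken ∘ σ) (lift λ ()) A ⟨ t ⟩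
  ·-update-⟨⟩ {σ = σ} A {x} {t} x#A =
    ≡.trans (subst-subst A (↦-# A x#A) λ _ → ↦-≡ σ x t)
            (≡.sym (subst-lift-⟨⟩ A refl (λ _ → refl) λ ()))

  sound : Γ ⟶ G → Instances σ Γ Ξ → ⟦ σ · G ⟧ Ξ
  sound {G = G} {σ = σ} init (i ∷ []) = ≡.subst ⟦ σ · G ⟧ (≡.sym (++-identityʳ _)) i
  sound {G = G} {σ = σ} (exch p d) is with permute (↭-sym p) is
  ... | _ , q , is′ = exchange (⟦⟧-closed (σ · G)) q (sound d is′)
  sound {G = G} {σ = σ} (⊗L d) (i ∷ is) = bind (⟦⟧-closed (σ · G)) i
    λ { (Ξ₁ , Ξ₂ , refl , a , b) →
      ≡.subst ⟦ σ · G ⟧ (≡.sym (++-assoc Ξ₁ Ξ₂ _)) (sound d (a ∷ b ∷ is)) }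
  sound (⊗R {Γ = Γ} d e) is with split Γ is
  ... | Ξ₁ , Ξ₂ , refl , is₁ , is₂ = Cl-unit (Ξ₁ , Ξ₂ , refl , sound d is₁ , sound e is₂)
  sound {G = G} {σ = σ} (𝟏L d) (i ∷ is) = bind (⟦⟧-closed (σ · G)) i
    λ { (lifted refl) → sound d is }
  sound 𝟏R [] = Cl-unit (lifted refl)
  sound {G = G} {σ = σ} (⊸L {Γ = Γ} d e) (_∷_ {Ξ = Ξ} f is) with split Γ is
  ... | Ξ₁ , Ξ₂ , refl , is₁ , is₂ =
    exchange (⟦⟧-closed (σ · G)) (rotate Ξ₁ Ξ Ξ₂) (sound e (f (sound d is₁) ∷ is₂))
  sound (⊸R d) is i = sound d (i ∷ is)
  sound (&L₁ d) ((a , b) ∷ is) = sound d (a ∷ is)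
  sound (&L₂ d) ((a , b) ∷ is) = sound d (b ∷ is)
  sound (&R d e) is = sound d is , sound e is
  sound ⊤R is = _
  sound {G = G} {σ = σ} 𝟎L (i ∷ is) = bind (⟦⟧-closed (σ · G)) i λ ()
  sound {G = G} {σ = σ} (∃L {A = A} x x#A x#Γ x#G d) (i ∷ is) = bind (⟦⟧-closed (σ · G)) i
    λ (t , a) → transport (·-update G x#G)
      (sound d (transport (≡.sym (·-update-⟨⟩ A x#A)) (from-instance (subst _ _ A) a)
                 ∷ Instances-update x#Γ is))
  sound (∃R {A = A} t d) is = Cl-unit
    (_ , to-instance (subst _ _ A) (transport (·-⟨⟩ A) (sound d is)))
  sound (∀L {A = A} t d) (f ∷ is) =
    sound d (transport (≡.sym (·-⟨⟩ A)) (from-instance (subst _ _ A) (f _)) ∷ is)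
  sound (∀R {A = A} x x#A x#Γ d) is t = to-instance (subst _ _ A)
    (transport (·-update-⟨⟩ A x#A) (sound d (Instances-update x#Γ is)))
  sound {G = G} {σ = σ} (der {F = F} d) (i ∷ is) =
    sound d (⟦⟧-closed (σ · F) (λ h → i λ (_ , f) → h f) ∷ is)
  sound (prom bs d) is = promote Cl-closed bs is λ bs′ is′ → Cl-unit (bs′ , sound d is′)
  sound {G = G} {σ = σ} (weak Ub d) (i ∷ is) = bind (⟦⟧-closed (σ · G)) i λ {Ξ} (bs , _) →
    adapt (⟦⟧-closed (σ · G))
      (λ {Θ} e → cast (≡.sym (++-assoc Ξ _ Θ)) (weaken-banged Ub bs e))
      (sound d is)
  -- Banged contexts are the generators of the closure, so it is opened first; `Ξ` may then be used
  -- twice and its copies contracted.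
  sound {G = G} {σ = σ} (contr Ub d) (i ∷ is) = bind (⟦⟧-closed (σ · G)) i λ {Ξ} (bs , f) →
    adapt (⟦⟧-closed (σ · G))
      (λ {Θ} e → cast (≡.sym (++-assoc Ξ _ Θ)) (contract-banged Ub bs
        (cast (≡.trans (++-assoc Ξ (Ξ ++ _) Θ) (cong (Ξ ++_) (++-assoc Ξ _ Θ))) e)))
      (sound d (Cl-unit (bs , f) ∷ Cl-unit (bs , f) ∷ is))

  free·-id : ∀ A → free · A ≡ A
  free·-id A = subst-id A (λ _ → refl) λ ()

  singletons : ∀ Γ → Instances free Γ Γ
  singletons []      = []
  singletons (A ∷ Γ) =
    transport (≡.sym (free·-id A)) (reflect (skeleton A) A refl) ∷ singletons Γ

  -- At the identity substitution, the value of `d` realises `A` in the evaluation of `e`, and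
  -- reading the result back gives a cut-free derivation.
  cut : Γ ⟶ A → A ∷ Γ′ ⟶ G → Γ ++ Γ′ ⟶ G
  cut {A = A} {Γ′ = Γ′} {G = G} d e =
    reify (skeleton G) G refl
      (transport (free·-id G) (sound e (sound d (singletons _) ∷ singletons Γ′)))

-- Structural rules for constraints.

module ConstraintEntailment {c ℓ f r} (𝒮 : SoftConstraintSystem c ℓ f r) where

  open SoftConstraintSystem 𝒮
  open CSemiring 𝒜 using (Carrier; ⊤; ≤-isPreorder)
  open Syntax Carrier 𝒫
  open SELL (softSignature 𝒜) 𝒫
  open Substitution Carrier 𝒫
  open CutAdmissibility (softSignature 𝒜) 𝒫

  private variable
    n       : ℕ
    Γ Γ′    : Context
    A B C G : Formula 0
    x       : Var

  extend : Term 0 → (Fin n → Term 0) → Fin (suc n) → Term 0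
  extend t ρ zero    = t
  extend t ρ (suc j) = ρ j

  instance-extend : ∀ (A : Formula (suc n)) {ρ t} →
                    subst (weaken ∘ free) (lift ρ) A ⟨ t ⟩ ≡ subst free (extend t ρ) A
  instance-extend A = subst-lift-⟨⟩ A refl (λ _ → refl) λ _ → refl

  -- Atoms of a constraint sit under a bang and every label is in `U`, so weakening descends through
  -- the grammar to `weak`. Dangling indices filled by `ρ` let the induction pass under the
  -- existential quantifier.
  weaken-constraint : ∀ {A : Formula n} {ρ} → IsConstraint A →
                      Γ ⟶ G → subst free ρ A ∷ Γ ⟶ G
  weaken-constraint 𝟏               d = 𝟏L d
  weaken-constraint 𝟎               d = 𝟎L
  weaken-constraint (p ⊗ q)         d = ⊗L (weaken-constraint p (weaken-constraint q d))
  weaken-constraint {Γ = Γ} {G = G} {ρ = ρ} (∃′ {A} p) d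
    with fresh-context Γ (fv (subst (weaken ∘ free) (lift ρ) A) ++ fv G)
  ... | x , x#Γ , x# =
    ∃L x (x# ∘ ∈-++⁺ˡ) x#Γ (x# ∘ ∈-++⁺ʳ (fv (subst (weaken ∘ free) (lift ρ) A)))
      (≡.subst (λ B → B ∷ Γ ⟶ G) (≡.sym (instance-extend A)) (weaken-constraint p d))
  weaken-constraint (!-atom a p ts) d = weak _ d
  weaken-constraint (!-tensor a p)  d = weak _ d

  ⊗R-init : A ∷ B ∷ [] ⟶ A ⊗ B
  ⊗R-init = ⊗R init init

  -- Invertibility of `⊗L`, obtained by cut.
  ⊗L⁻ : A ⊗ B ∷ Γ ⟶ G → A ∷ B ∷ Γ ⟶ G
  ⊗L⁻ = cut ⊗R-init

  -- The single copy is decomposed, and cuts replace both copies in the premise by components, to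
  -- which induction applies.
  contract-constraint : ∀ {A : Formula n} {ρ} → IsConstraint A →
    subst free ρ A ∷ subst free ρ A ∷ Γ ⟶ G → subst free ρ A ∷ Γ ⟶ G
  contract-constraint 𝟏               d = cut 𝟏R d
  contract-constraint 𝟎               d = 𝟎L
  contract-constraint {Γ = Γ} {G = G} {ρ = ρ} (_⊗_ {A} {B} p q) d =
    ⊗L (contract-constraint p (exch (shifts [ B′ ] (A′ ∷ A′ ∷ []))
      (contract-constraint q (exch
        (↭-trans (shifts (A′ ∷ B′ ∷ A′ ∷ []) [ B′ ]) (prep B′ (shifts [ A′ ] [ B′ ])))
        (⊗L⁻ (exch (shifts (A′ ∷ B′ ∷ []) [ A′ ⊗ B′ ]) (⊗L⁻ d)))))))
    where
    A′ = subst free ρ A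
    B′ = subst free ρ B
  contract-constraint {Γ = Γ} {G = G} {ρ = ρ} (∃′ {A} p) d
    with fresh-context Γ (fv (subst (weaken ∘ free) (lift ρ) A) ++ fv G)
  ... | x , x#Γ , x# =
    ∃L x (x# ∘ ∈-++⁺ˡ) x#Γ (x# ∘ ∈-++⁺ʳ (fv (subst (weaken ∘ free) (lift ρ) A)))
      (≡.subst (λ B → B ∷ Γ ⟶ G) (≡.sym (instance-extend A)) (contract-constraint p
        -- One eigenvariable witnesses both existentials, leaving two equal instances to contract.
        (cut witness (exch (swap _ _ refl) (cut witness d)))))
    where
    witness : [ subst free (extend (free x) ρ) A ] ⟶ ∃′ (subst (weaken ∘ free) (lift ρ) A)
    witness = ∃R (free x) (cast (cong [_] (instance-extend A)) init)
  contract-constraint (!-atom a p ts) d = contr _ d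
  contract-constraint (!-tensor a p)  d = contr _ d

  weaken-𝒞 : (C : 𝒞) → Γ ⟶ G → proj₁ C ∷ Γ ⟶ G
  weaken-𝒞 {Γ = Γ} {G = G} (C , p) d =
    ≡.subst (λ B → B ∷ Γ ⟶ G) (free·-id C) (weaken-constraint p d)

  contract-𝒞 : (C : 𝒞) → proj₁ C ∷ proj₁ C ∷ Γ ⟶ G → proj₁ C ∷ Γ ⟶ G
  contract-𝒞 {Γ = Γ} {G = G} (C , p) =
    ≡.subst (λ B → B ∷ B ∷ Γ ⟶ G → B ∷ Γ ⟶ G) (free·-id C) (contract-constraint p)

  ∃R-self : ∀ x → Γ ⟶ A → Γ ⟶ ∃[ x ] A
  ∃R-self {Γ = Γ} {A = A} x d = ∃R (free x) (≡.subst (Γ ⟶_) (≡.sym (abstr-⟨free⟩ x A)) d)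

  -- Abstraction removes `x` from the body, so `x` can serve as its own eigenvariable, and the
  -- instance is `A` again.
  ∃L-self : ∀ x → All (x #_) Γ → x # G → A ∷ Γ ⟶ G → ∃[ x ] A ∷ Γ ⟶ G
  ∃L-self {Γ = Γ} {G = G} {A = A} x x#Γ x#G d =
    ∃L x (#-abstr x A) x#Γ x#G (≡.subst (λ B → B ∷ Γ ⟶ G) (≡.sym (abstr-⟨free⟩ x A)) d)

  -- Entailment modulo the axioms.

  fv-∀* : ∀ xs A → x ∈ fv (foldr ∀[_]_ A xs) → x ∈ fv A × x ∉ xs
  fv-∀* []       A x∈ = x∈ , λ ()
  fv-∀* (y ∷ xs) A x∈ with fv-abstr (foldr ∀[_]_ A xs) x∈
  ... | x∈′ , x≢y with fv-∀* xs A x∈′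
  ...   | x∈A , x∉xs = x∈A , λ { (here x≡y) → x≢y x≡y ; (there x∈xs) → x∉xs x∈xs }

  -- The quantifier prefix binds all variables of both sides. Hence any variable may serve as an
  -- eigenvariable beside the axioms.
  axiom-closed : ∀ δ → x # Axiom.formula δ
  axiom-closed δ x∈ with fv-∀* (Axiom.vars δ) _ x∈
  ... | x∈⊸ , x∉ with ∈-++⁻ (fv (proj₁ (Axiom.lhs δ))) x∈⊸
  ...   | inj₁ x∈l = x∉ (Axiom.lhs-fv⊆ δ x∈l)
  ...   | inj₂ x∈r = x∉ (Axiom.rhs-fv⊆ δ x∈r)

  axioms : Context
  axioms = map (λ δ → ! ⊤ (Axiom.formula δ)) Δ

  axioms-banged : All (BangedAbove ⊤) axioms
  axioms-banged = All.map⁺ (All.universal (λ _ → banged (IsPreorder.refl ≤-isPreorder)) Δ)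

  axioms-closed : ∀ x → All (x #_) axioms
  axioms-closed x = All.map⁺ (All.universal axiom-closed Δ)

  infix 3 _⊩_
  _⊩_ : Context → Formula 0 → Set _
  Γ ⊩ C = axioms ++ Γ ⟶ C

  logical : Γ ⟶ C → Γ ⊩ C
  logical = weaken-banged _ axioms-banged

  exch⊩ : Γ ↭ Γ′ → Γ ⊩ C → Γ′ ⊩ C
  exch⊩ p = exch (++⁺ˡ axioms p)

  to-front : A ∷ Γ ⊩ C → A ∷ axioms ++ Γ ⟶ C
  to-front {A = A} {Γ = Γ} = exch (shift A axioms Γ)

  from-front : A ∷ axioms ++ Γ ⟶ C → A ∷ Γ ⊩ C
  from-front {A = A} {Γ = Γ} = exch (↭-sym (shift A axioms Γ))

  -- A plain cut leaves two copies of the axioms, which are contracted since all are banged.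
  cut⊩ : Γ ⊩ A → A ∷ Γ′ ⊩ C → Γ ++ Γ′ ⊩ C
  cut⊩ {Γ = Γ} {Γ′ = Γ′} d e = contract-banged _ axioms-banged (exch
    (↭-trans (↭-reflexive (++-assoc axioms Γ (axioms ++ Γ′)))
      (++⁺ˡ axioms (shifts Γ axioms)))
    (cut d (to-front e)))

  ⊗L⊩ : A ∷ B ∷ Γ ⊩ C → A ⊗ B ∷ Γ ⊩ C
  ⊗L⊩ {A = A} {B = B} {Γ = Γ} d = from-front (⊗L (exch
    (↭-trans (shift A axioms (B ∷ Γ)) (prep A (shift B axioms Γ))) d))

  ⊗L⊩⁻ : [ A ⊗ B ] ⊩ C → A ∷ B ∷ [] ⊩ C
  ⊗L⊩⁻ = cut⊩ (logical ⊗R-init)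

  ⊩-refl : [ A ] ⊩ A
  ⊩-refl = logical init

  -- Tensor as least upper bound, and the laws of cylindrification.

  ⊗-upperˡ : ∀ A (B : 𝒞) → [ A ⊗ proj₁ B ] ⊩ A
  ⊗-upperˡ A B = logical (⊗L (exch (swap _ _ refl) (weaken-𝒞 B init)))

  ⊗-upperʳ : ∀ (A : 𝒞) B → [ proj₁ A ⊗ B ] ⊩ B
  ⊗-upperʳ A B = logical (⊗L (weaken-𝒞 A init))

  -- Each of the two entailments consumes its own copy of `C`; contraction supplies the second.
  ⊗-least : (C : 𝒞) → [ proj₁ C ] ⊩ A → [ proj₁ C ] ⊩ B → [ proj₁ C ] ⊩ A ⊗ B
  ⊗-least C d e = from-front (contract-𝒞 C (exch
    (↭-trans (shift _ axioms _) (prep _ (shift _ axioms _)))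
    (cut⊩ d (exch⊩ (swap _ _ refl) (cut⊩ e (exch⊩ (swap _ _ refl) (logical ⊗R-init)))))))

  ∃-mono : ∀ x → [ A ] ⊩ B → [ ∃[ x ] A ] ⊩ ∃[ x ] B
  ∃-mono {B = B} x d =
    from-front (∃L-self x (All.++⁺ (axioms-closed x) []) (#-abstr x B)
      (∃R-self x (to-front d)))

  ∃-frobenius : ∀ x A B → [ ∃[ x ] (A ⊗ ∃[ x ] B) ] ⟶ ∃[ x ] A ⊗ ∃[ x ] B
  ∃-frobenius x A B = ∃L-self x [] x# (⊗L (⊗R (∃R-self x init) init))
    where
    x# : x # (∃[ x ] A ⊗ ∃[ x ] B)
    x# x∈ with ∈-++⁻ (fv (abstr x A)) x∈
    ... | inj₁ x∈A = #-abstr x A x∈A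
    ... | inj₂ x∈B = #-abstr x B x∈B

  -- As `x` is not free in `∃[ x ] B`, that factor may stay in the side context while the other
  -- quantifier is opened at `x`.
  ∃-frobenius⁻ : ∀ x A B → [ ∃[ x ] A ⊗ ∃[ x ] B ] ⟶ ∃[ x ] (A ⊗ ∃[ x ] B)
  ∃-frobenius⁻ x A B = ⊗L
    (∃L-self x (#-abstr x B ∷ []) (#-abstr x (A ⊗ ∃[ x ] B)) (∃R-self x ⊗R-init))

  -- The variables are their own eigenvariables, and the freshness conditions hold even when `x` and
  -- `y` coincide.
  ∃-comm : ∀ x y A → [ ∃[ x ] ∃[ y ] A ] ⟶ ∃[ y ] ∃[ x ] A
  ∃-comm x y A =
    ∃L-self x [] (#-abstr x A ∘ proj₁ ∘ fv-abstr (∃[ x ] A))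
      (∃L-self y [] (#-abstr y (∃[ x ] A)) (∃R-self y (∃R-self x init)))

  -- Diagonal elements from the equality theory.

  module Equality {eq : PredSym 2} (theory : IsEqualityTheory eq) where

    open IsEqualityTheory theory

    private
      E : Var → Var → Formula 0
      E x y = proj₁ (equation eq x y)

      equate : Term 0 → Term 0 → Formula 0
      equate s t = ! ⊤ (atom eq (s ∷ t ∷ []))

    E-substˡ : ∀ {x y} z → y ≢ x → E x y [ z / x ] ≡ E z y
    E-substˡ {x} z y≢x = cong₂ equate (single-≡ x (free z)) (single-≢ (free z) y≢x)

    E-substʳ : ∀ {x y} z → x ≢ y → E x y [ z / y ] ≡ E x z
    E-substʳ {y = y} z x≢y = cong₂ equate (single-≢ (free z) x≢y) (single-≡ y (free z))

    E-refl : ∀ x → [] ⊩ E x x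
    E-refl x = cut⊩ (logical 𝟏R) (reflexivity x)

    -- Replacing `z` by `y` in `E x z` gives `E x y`, where `z ≢ x` keeps the left side fixed.
    E-trans : ∀ {x y z} → z ≢ x → E x z ∷ E z y ∷ [] ⊩ E x y
    E-trans {x} {y} {z} z≢x = exch⊩ (swap _ _ refl) (⊗L⊩⁻
      (≡.subst ([ E z y ⊗ E x z ] ⊩_) (E-substʳ y (z≢x ∘ ≡.sym))
        (replacement z y (equation eq x z))))

    ∃-diagonal : ∀ {x y z} → z ≢ x → z ≢ y → [ ∃[ z ] (E x z ⊗ E z y) ] ⊩ E x y
    ∃-diagonal {x} {y} {z} z≢x z≢y =
      from-front (∃L-self z (All.++⁺ (axioms-closed z) [])
        (λ { (here z≡x) → z≢x z≡x ; (there (here z≡y)) → z≢y z≡y })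
        (to-front (⊗L⊩ (E-trans z≢x))))

    diagonal-∃ : ∀ {x y z} → z ≢ x → z ≢ y → [ E x y ] ⊩ ∃[ z ] (E x z ⊗ E z y)
    -- The witness `y` turns the body into `E x y ⊗ E y y`, whose second factor is reflexivity.
    diagonal-∃ {x} {y} {z} z≢x z≢y = ∃R (free y)
      (≡.subst ([ E x y ] ⊩_) (≡.sym (≡.trans (abstr-⟨⟩ z (E x z ⊗ E z y) y) (cong₂ _⊗_
          (E-substʳ y (z≢x ∘ ≡.sym))
          (E-substˡ y (z≢y ∘ ≡.sym)))))
        (cut⊩ (E-refl y) (exch⊩ (swap _ _ refl) (logical ⊗R-init))))

    -- The witness z of ∃x(a ⊗ x=y) satisfies z=y, so x=y yields x=z and a[z/x] becomes a.
    ∃-replace : ∀ {x y} → x ≢ y → (A : 𝒞) →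
                [ E x y ⊗ ∃[ x ] (proj₁ A ⊗ E x y) ] ⊩ proj₁ A
    -- Besides `A`, the eigenvariable must avoid `E x y`, which stays in the context; `z ≢ x` also
    -- serves the rewriting of `E x z`.
    ∃-replace {x} {y} x≢y A⁺@(A , _) with fresh (x ∷ y ∷ fv A)
    ... | z , z∉ =
      ⊗L⊩ (exch⊩ (swap _ _ refl) (from-front
        (∃L z z#body (All.++⁺ (axioms-closed z) (z#xy ∷ [])) (z∉ ∘ there ∘ there)
          (to-front (≡.subst (λ B → B ∷ E x y ∷ [] ⊩ A) (≡.sym instance-z)
            replaced)))))
      where
      z≢x : z ≢ x
      z≢x = z∉ ∘ here
      z#xy : z # E x y
      z#xy (here z≡x)         = z≢x z≡x
      z#xy (there (here z≡y)) = z∉ (there (here z≡y))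
      z#body : z # abstr x (A ⊗ E x y)
      z#body z∈ with ∈-++⁻ (fv A) (proj₁ (fv-abstr (A ⊗ E x y) z∈))
      ... | inj₁ z∈A = z∉ (there (there z∈A))
      ... | inj₂ z∈E = z#xy z∈E
      instance-z : abstr x (A ⊗ E x y) ⟨ free z ⟩ ≡ A [ z / x ] ⊗ E z y
      instance-z = ≡.trans (abstr-⟨⟩ x (A ⊗ E x y) z)
        (cong (A [ z / x ] ⊗_) (E-substˡ z (x≢y ∘ ≡.sym)))
      x=z : E z y ∷ E x y ∷ [] ⊩ E x z
      -- `E x y` is `E x z` with `z` replaced by `y`, so replacement read backwards along `E z y`
      -- recovers `E x z`.
      x=z = ⊗L⊩⁻ (≡.subst (λ B → [ E z y ⊗ B ] ⊩ E x z)
        (E-substʳ y (z≢x ∘ ≡.sym))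
        (replacement′ z y (equation eq x z)))
      replaced : A [ z / x ] ⊗ E z y ∷ E x y ∷ [] ⊩ A
      replaced = ⊗L⊩ (exch⊩ (shifts (E z y ∷ E x y ∷ []) [ A [ z / x ] ])
        (cut⊩ x=z (⊗L⊩⁻ (replacement′ x z A⁺))))

theorem1 : ∀ {c ℓ f r} (𝒮 : SoftConstraintSystem c ℓ f r) →
    let open SoftConstraintSystem 𝒮 in
    (eq : PredSym 2) → IsEqualityTheory eq →
    IsCylindricConstraintSystem {V = Var} _≤_ _⊗ᶜ_ 𝟏ᶜ 𝟎ᶜ ∃ᶜ (Diagonals eq) (equation eq)
theorem1 𝒮 eq theory = record
  { isBoundedJoinSemilattice = record
    { isJoinSemilattice = record
      { isPartialOrder = record
        { isPreorder = record
          { isEquivalence = record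
            { refl  = ⊩-refl , ⊩-refl
            ; sym   = λ (p , q) → q , p
            ; trans = λ (p , q) (p′ , q′) → cut⊩ p′ p , cut⊩ q q′
            }
          ; reflexive = proj₁
          -- The order is reversed entailment, so the cut takes the second inequality first.
          ; trans     = λ p q → cut⊩ q p
          }
        ; antisym = _,_
        }
      ; supremum = λ a b →
          ⊗-upperˡ (proj₁ a) b , ⊗-upperʳ a (proj₁ b) , λ c → ⊗-least c
      }
    ; minimum = λ a → logical (weaken-𝒞 a 𝟏R)
    }
  ; maximum     = λ _ → logical 𝟎L
  ; denumerable = ↔-id Var
  ; E1          = λ x _ → logical (∃R-self x init)
  ; E2          = λ x → ∃-mono x
  ; E3          = λ x (a , _) (b , _) →
      logical (∃-frobenius⁻ x a b) , logical (∃-frobenius x a b)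
  ; E4          = λ x y (a , _) → logical (∃-comm y x a) , logical (∃-comm x y a)
  ; diagonal    = λ x y → x , y , refl
  ; D1          = λ x → reflexivity x , logical (weaken-𝒞 (equation eq x x) 𝟏R)
  ; D2          = λ _ _ _ z≢x z≢y → ∃-diagonal z≢x z≢y , diagonal-∃ z≢x z≢y
  ; D3          = λ _ _ a x≢y → ∃-replace x≢y a
  }
  where
  open SoftConstraintSystem 𝒮
  open SELL (softSignature 𝒜) 𝒫
  open ConstraintEntailment 𝒮
  open Equality theory
  open IsEqualityTheory theory
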